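{- Each column of the forward adjacency matrix $\mathbf{A}$ has at most two non-zero entries: one is the diagonal entry, which is $1$, while the other (if present) is $-1$.
   Context: Let $G$ be a finite tree (connected acyclic simple graph) with nodes $n_0,n_1,\dots,n_N$, $N\ge 1$, where $n_0$ is a terminal node (degree one) and the nodes are indexed so that along the path in $G$ from $n_0$ to any node $n_i$ the successively encountered node indices strictly increase. Node $n_i$ is forward-adjacent to $n_k$ if $n_i$ and $n_k$ are adjacent and $i<k$. The forward adjacency matrix $\mathbf{A}$ of $G$ is the $N\times N$ matrix, with rows and columns indexed by $1,\dots,N$, given by $\mathbf{A}(i,j)=1$ if $i=j$, $\mathbf{A}(i,j)=-1$ if $n_i$ is forward-adjacent to $n_j$, and $\mathbf{A}(i,j)=0$ otherwise. -}

module Defs where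

open import Level using (0ℓ)
open import Data.Bool using (if_then_else_)
open import Data.Nat using (ℕ; suc; _≤_)
open import Data.Fin using (Fin; zero; suc; _<_; _<?_; _≟_)
open import Data.Integer using (ℤ; 0ℤ; 1ℤ; -1ℤ)
import Data.Integer as ℤ
open import Data.List using (List; _∷_; [_]; length; filter; drop; allFin)
open import Data.List.Relation.Unary.Linked using (Linked)
open import Data.List.Relation.Unary.Unique.Propositional using (Unique)
open import Data.Product using (_×_)
open import Data.Vec.Functional using (Vector)
open import Relation.Binary.Core using (Rel)
open import Relation.Binary.Definitions using (Symmetric; Decidable)
open import Relation.Binary.Construct.Closure.ReflexiveTransitive using (Star; ε; _◅_)
open import Relation.Binary.PropositionalEquality using (_≡_)
open import Relation.Nullary using (¬_; does; ¬?; _×-dec_)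

record SimpleGraph (n : ℕ) : Set₁ where
  field
    Adj    : Rel (Fin n) 0ℓ
    adj?   : Decidable Adj
    sym    : Symmetric Adj
    irrefl : ∀ {u} → ¬ Adj u u

module _ {n : ℕ} (G : SimpleGraph n) where
  open SimpleGraph G

  Walk : Rel (Fin n) 0ℓ
  Walk = Star Adj

  -- All nodes met, both endpoints included; a closed walk lists its
  -- base point twice.
  vertices : ∀ {u v} → Walk u v → List (Fin n)
  vertices {u} ε       = [ u ]
  vertices {u} (_ ◅ p) = u ∷ vertices p

  IsPath : ∀ {u v} → Walk u v → Set
  IsPath p = Unique (vertices p)

  -- A closed walk with at least three edges (hence four listed nodes) whose
  -- only repetition is that the last node equals the first.
  IsCycle : ∀ {u} → Walk u u → Set
  IsCycle p = 4 ≤ length (vertices p) × Unique (drop 1 (vertices p))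

  Connected : Set
  Connected = ∀ u v → Walk u v

  Acyclic : Set
  Acyclic = ∀ {u} (p : Walk u u) → ¬ IsCycle p

  IsTree : Set
  IsTree = Connected × Acyclic

  degree : Fin n → ℕ
  degree u = length (filter (adj? u) (allFin n))

  IsTerminal : Fin n → Set
  IsTerminal u = degree u ≡ 1

  ForwardAdjacent : Rel (Fin n) 0ℓ
  ForwardAdjacent i k = Adj i k × i < k

  forwardAdjacent? : Decidable ForwardAdjacent
  forwardAdjacent? i k = adj? i k ×-dec (i <? k)

IncreasingFromRoot : ∀ {N} → SimpleGraph (suc N) → Set
IncreasingFromRoot G =
  ∀ i (p : Walk G zero i) → IsPath G p → Linked _<_ (vertices G p)

Matrix : ℕ → Set
Matrix N = Vector (Vector ℤ N) N

-- Rows and columns range over the nodes 1, …, N only: the matrix index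
-- i : Fin N stands for the node suc i : Fin (suc N).
forwardAdjacencyMatrix : ∀ {N} → SimpleGraph (suc N) → Matrix N
forwardAdjacencyMatrix G i j =
  if does (i ≟ j) then 1ℤ
  else if does (forwardAdjacent? G (suc i) (suc j)) then -1ℤ
  else 0ℤ

nonZerosInColumn : ∀ {N} → Matrix N → Fin N → List (Fin N)
nonZerosInColumn {N} A j = filter (λ i → ¬? (A i j ℤ.≟ 0ℤ)) (allFin N)

{-# OPTIONS --safe #-}

-- A node k has at most one smaller neighbour.  If i < i′ were two of them, take
-- the path from the root to i: being increasing, it avoids i′ and k, so it
-- extends by k and then i′ to a path from the root that is not increasing.
-- Off-diagonal non-zero entries of column k sit exactly at smaller neighbours.
module Submission where

open import Defs
open import Data.Bool using (if_then_else_)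
open import Data.Nat using (ℕ; suc; _≤_; z≤n; s≤s)
open import Data.Nat.Properties using (≤-refl; ≤-trans; <⇒≤; <⇒≱; <⇒≢)
open import Data.Fin using (Fin; zero; suc; _≟_; _<_; toℕ)
open import Data.Fin.Properties using (<-cmp; suc-injective)
open import Data.Integer using (0ℤ; 1ℤ; -1ℤ)
import Data.Integer as ℤ
open import Data.List using (List; []; _∷_; _++_; length; allFin)
open import Data.List.Membership.Propositional using (_∈_; _∉_)
open import Data.List.Membership.Propositional.Properties using (∈-filter⁻; ∈-++⁺ʳ)
open import Data.List.Membership.DecPropositional using (_∈?_)
open import Data.List.Relation.Unary.All using ([]; _∷_)
open import Data.List.Relation.Unary.All.Properties using (¬Any⇒All¬)
open import Data.List.Relation.Unary.AllPairs using ([]; _∷_)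
open import Data.List.Relation.Unary.Any using (here; there)
open import Data.List.Relation.Unary.Linked using (Linked; _∷_)
open import Data.List.Relation.Unary.Unique.Propositional using (Unique)
open import Data.List.Relation.Unary.Unique.Propositional.Properties using (allFin⁺; filter⁺; ++⁺)
open import Data.Product using (_×_; _,_; proj₁; proj₂; ∃)
open import Relation.Binary.Construct.Closure.ReflexiveTransitive using (ε; _◅_; _◅◅_)
open import Relation.Binary.Definitions using (DecidableEquality; tri<; tri≈; tri>)
open import Relation.Binary.PropositionalEquality using (_≡_; _≢_; refl; sym; cong; subst)
open import Relation.Nullary using (¬_; ¬?; Dec; does; yes; no; contradiction)

-- Among three distinct entries at most one equals `z`, so two distinct ones avoid `z`, and `eq`
-- identifies them. In the application `z` is the diagonal index of the column.
length≤2 : ∀ {a} {A : Set a} → DecidableEquality A → (z : A) {xs : List A} → Unique xs →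
           (∀ {x y} → x ∈ xs → y ∈ xs → x ≢ z → y ≢ z → x ≡ y) → length xs ≤ 2
length≤2 _≟ᴬ_ z {[]}         u eq = z≤n
length≤2 _≟ᴬ_ z {_ ∷ []}     u eq = s≤s z≤n
length≤2 _≟ᴬ_ z {_ ∷ _ ∷ []} u eq = s≤s (s≤s z≤n)
length≤2 _≟ᴬ_ z {a ∷ b ∷ c ∷ _} ((a≢b ∷ a≢c ∷ _) ∷ (b≢c ∷ _) ∷ _) eq with a ≟ᴬ z | b ≟ᴬ z
... | yes refl | _        = contradiction
  (eq (there (here refl)) (there (there (here refl))) (λ b≡z → a≢b (sym b≡z)) (λ c≡z → a≢c (sym c≡z))) b≢c
... | no a≢z   | yes refl = contradiction
  (eq (here refl) (there (there (here refl))) a≢z (λ c≡z → b≢c (sym c≡z))) a≢c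
... | no a≢z   | no b≢z   = contradiction (eq (here refl) (there (here refl)) a≢z b≢z) a≢b

-- Here the decision is a variable, so matching on it reduces the `if`. For a concrete product
-- decision such as `forwardAdjacent?`, `does` unfolds to a conjunction of two booleans.
if-dec-≢else : ∀ {p a} {P : Set p} {A : Set a} {x y : A} (P? : Dec P) →
               (if does P? then x else y) ≢ y → P × (if does P? then x else y) ≡ x
if-dec-≢else (yes p) _   = p , refl
if-dec-≢else (no _)  y≢y = contradiction refl y≢y

module _ {n : ℕ} (G : SimpleGraph n) where
  open SimpleGraph G using (Adj)

  suffixPath : ∀ {u v w} (p : Walk G u v) → IsPath G p → w ∈ vertices G p →
               ∃ λ (q : Walk G w v) → IsPath G q
  suffixPath ε       p-path       (here refl) = ε , p-path
  suffixPath (a ◅ p) p-path       (here refl) = a ◅ p , p-path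
  suffixPath (a ◅ p) (_ ∷ p-path) (there w∈p) = suffixPath p p-path w∈p

  -- Loop erasure, working back from the end: if the new start `u` already lies on the path built
  -- for the rest, the part of that path from `u` onwards is taken instead.
  walk⇒path : ∀ {u v} → Walk G u v → ∃ λ (q : Walk G u v) → IsPath G q
  walk⇒path ε = ε , [] ∷ []
  walk⇒path {u} (a ◅ p) with walk⇒path p
  ... | q , q-path with _∈?_ _≟_ u (vertices G q)
  ...   | yes u∈q = suffixPath q q-path u∈q
  ...   | no  u∉q = a ◅ q , ¬Any⇒All¬ _ u∉q ∷ q-path

  -- The connecting edge `a` keeps the two vertex lists apart. Walks glued at a shared node would
  -- list that node in both.
  vertices-◅◅ : ∀ {u v w x} (p : Walk G u v) (a : Adj v w) (q : Walk G w x) →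
                vertices G (p ◅◅ a ◅ q) ≡ vertices G p ++ vertices G q
  vertices-◅◅ ε       a q = refl
  vertices-◅◅ (b ◅ p) a q = cong (_ ∷_) (vertices-◅◅ p a q)

  -- Chains the consecutive comparisons up to the last node. A nonempty walk is split one edge
  -- further because `Linked` compares the first two listed nodes, and `vertices` of the tail shows
  -- its head only after that split.
  increasing⇒≤end : ∀ {u v} (p : Walk G u v) → Linked _<_ (vertices G p) →
                    ∀ {x} → x ∈ vertices G p → toℕ x ≤ toℕ v
  increasing⇒≤end ε _ (here refl) = ≤-refl
  increasing⇒≤end (_ ◅ ε)     (u<v ∷ _)   (here refl) = <⇒≤ u<v
  increasing⇒≤end (_ ◅ b ◅ p) (u<w ∷ inc) (here refl) =
    ≤-trans (<⇒≤ u<w) (increasing⇒≤end (b ◅ p) inc (here refl))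
  increasing⇒≤end (_ ◅ ε)     (_ ∷ inc)   (there x∈p) = increasing⇒≤end ε inc x∈p
  increasing⇒≤end (_ ◅ b ◅ p) (_ ∷ inc)   (there x∈p) = increasing⇒≤end (b ◅ p) inc x∈p

module _ {N : ℕ} (G : SimpleGraph (suc N)) where
  open SimpleGraph G using () renaming (sym to adj-sym)

  ¬two-smaller-neighbours : Connected G → IncreasingFromRoot G → ∀ {i i′ k} → i < i′ →
                            ForwardAdjacent G i k → ¬ ForwardAdjacent G i′ k
  ¬two-smaller-neighbours conn inc {i} {i′} {k} i<i′ (i~k , i<k) (i′~k , i′<k) =
    -- `q` meets `k` just before its last node `i′`, so increase along `q` would force `k` to be at
    -- most `i′`.
    <⇒≱ i′<k (increasing⇒≤end G q (inc i′ q q-path) k∈q)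
    where
    p      = proj₁ (walk⇒path G (conn zero i))
    p-path = proj₂ (walk⇒path G (conn zero i))

    end : Walk G k i′
    end = adj-sym i′~k ◅ ε

    q : Walk G zero i′
    q = p ◅◅ i~k ◅ end

    q-vertices : vertices G q ≡ vertices G p ++ vertices G end
    q-vertices = vertices-◅◅ G p i~k end

    k∈q : k ∈ vertices G q
    k∈q = subst (k ∈_) (sym q-vertices) (∈-++⁺ʳ (vertices G p) (here refl))

    -- The increasing path `p` ends at `i`, its largest node. Both nodes of `end`, namely `k` and
    -- `i′`, exceed `i`; for `i′` this is the assumption `i<i′`.
    ∉p : ∀ {x} → i < x → x ∉ vertices G p
    ∉p i<x x∈p = <⇒≱ i<x (increasing⇒≤end G p (inc i p p-path) x∈p)

    disjoint : ∀ {x} → ¬ (x ∈ vertices G p × x ∈ vertices G end)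
    disjoint (x∈p , here refl)         = ∉p i<k x∈p
    disjoint (x∈p , there (here refl)) = ∉p i<i′ x∈p

    end-path : IsPath G end
    end-path = ((λ k≡i′ → <⇒≢ i′<k (cong toℕ (sym k≡i′))) ∷ []) ∷ [] ∷ []

    q-path : IsPath G q
    q-path = subst Unique (sym q-vertices) (++⁺ p-path end-path disjoint)

  smaller-neighbour-unique : Connected G → IncreasingFromRoot G → ∀ {i i′ k} →
                             ForwardAdjacent G i k → ForwardAdjacent G i′ k → i ≡ i′
  smaller-neighbour-unique conn inc {i} {i′} f f′ with <-cmp i i′
  ... | tri< i<i′ _ _ = contradiction f′ (¬two-smaller-neighbours conn inc i<i′ f)
  ... | tri≈ _ i≡i′ _ = i≡i′
  ... | tri> _ _ i′<i = contradiction f (¬two-smaller-neighbours conn inc i′<i f′)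

  diagonal-entry : ∀ j → forwardAdjacencyMatrix G j j ≡ 1ℤ
  diagonal-entry j with j ≟ j
  ... | yes _  = refl
  ... | no j≢j = contradiction refl j≢j

  off-diagonal-entry : ∀ i j → i ≢ j → forwardAdjacencyMatrix G i j ≢ 0ℤ →
                       ForwardAdjacent G (suc i) (suc j) × forwardAdjacencyMatrix G i j ≡ -1ℤ
  off-diagonal-entry i j i≢j A≢0 with i ≟ j
  ... | yes i≡j = contradiction i≡j i≢j
  ... | no _    = if-dec-≢else (forwardAdjacent? G (suc i) (suc j)) A≢0

lemma3 : ∀ (N : ℕ) → 1 ≤ N →
    (G : SimpleGraph (suc N)) → IsTree G → IsTerminal G zero → IncreasingFromRoot G →
    let A = forwardAdjacencyMatrix G in
    (j : Fin N) →
    length (nonZerosInColumn A j) ≤ 2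
    × A j j ≡ 1ℤ
    × (∀ i → i ≢ j → A i j ≢ 0ℤ → A i j ≡ -1ℤ)
lemma3 N _ G (conn , _) _ inc j =
    -- Two non-zero rows other than `j` give smaller neighbours of the node `suc j`. These are equal
    -- as nodes, and `suc-injective` takes the equality back to row indices.
    length≤2 _≟_ j (filter⁺ nonZero? (allFin⁺ N))
      (λ x∈ y∈ x≢j y≢j → suc-injective
        (smaller-neighbour-unique G conn inc (forward x∈ x≢j) (forward y∈ y≢j)))
  , diagonal-entry G j
  , λ i i≢j A≢0 → proj₂ (off-diagonal-entry G i j i≢j A≢0)
  where
  A = forwardAdjacencyMatrix G
  nonZero? = λ i → ¬? (A i j ℤ.≟ 0ℤ)

  forward : ∀ {i} → i ∈ nonZerosInColumn A j → i ≢ j → ForwardAdjacent G (suc i) (suc j)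
  forward {i} i∈ i≢j =
    proj₁ (off-diagonal-entry G i j i≢j (proj₂ (∈-filter⁻ nonZero? {xs = allFin N} i∈)))
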